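{- Let $m,n$ be positive integers and let $K_{m,n}$ be the complete bipartite graph with part sizes $m$ and $n$. Then the number of shellings of $K_{m,n}$ is $$F(K_{m,n})=\frac{m!\,n!\,(mn)!}{(m+n-1)!}.$$
   Context: For a finite undirected graph $G=(V,E)$, a shelling of $G$ is a total ordering $\sigma(1),\sigma(2),\ldots,\sigma(|E|)$ of the edge set $E$ such that for every $k=1,\ldots,|E|$ the edges $\sigma(1),\ldots,\sigma(k)$ form a connected subgraph of $G$. $F(G)$ denotes the number of shellings of $G$. -}

module Defs where

open import Data.Nat using (ℕ; zero; suc; _+_; _*_)
open import Data.Fin using (Fin; toℕ; _↑ˡ_; _↑ʳ_; remQuot)
open import Data.Fin.Properties using (_≟_; all?; any?)
open import Data.List using (List; []; _∷_; length; filter; take; allFin; cartesianProductWith)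
open import Data.List.Membership.Propositional using (_∈_)
open import Data.List.Membership.Propositional.Properties using (∈-allFin; ∈-cartesianProductWith⁺)
open import Data.List.Relation.Unary.Any as Any using (Any; here; there)
open import Data.List.Relation.Unary.All as All using ()
open import Data.List.Relation.Unary.AllPairs as AllPairs using ()
open import Data.List.Relation.Unary.Unique.Propositional using (Unique)
open import Data.List.Relation.Unary.Unique.Propositional.Properties using (allFin⁺; cartesianProductWith⁺)
open import Data.Product using (_×_; _,_; proj₁; proj₂; ∃)
open import Data.Sum using (_⊎_; inj₁; inj₂)
open import Data.Vec as Vec using (Vec; lookup; toList)
open import Data.Vec.Properties using (∷-injective)
open import Function.Definitions using (Injective; Surjective; Bijective)
open import Relation.Binary.Construct.Closure.ReflexiveTransitive as Star using (Star; ε; _◅_; _◅◅_)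
open import Relation.Binary.PropositionalEquality using (_≡_; refl; sym; trans; cong)
open import Relation.Nullary using (Dec; yes; no)
open import Relation.Nullary.Decidable using (map′; _×-dec_; _⊎-dec_; _→-dec_)

-- Edges are undirected: the order of the pair `ends e` is ignored by
-- everything below.  Loops and parallel edges are permitted.
record Graph : Set where
  field
    ∣V∣  : ℕ
    ∣E∣  : ℕ
    ends : Fin ∣E∣ → Fin ∣V∣ × Fin ∣V∣

  V : Set
  V = Fin ∣V∣

  E : Set
  E = Fin ∣E∣

module _ (G : Graph) where
  open Graph G

  Joins : E → V → V → Set
  Joins e u v = (proj₁ (ends e) ≡ u × proj₂ (ends e) ≡ v)
              ⊎ (proj₁ (ends e) ≡ v × proj₂ (ends e) ≡ u)

  Incident : V → E → Set
  Incident v e = proj₁ (ends e) ≡ v ⊎ proj₂ (ends e) ≡ v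

  Adjacent : List E → V → V → Set
  Adjacent es u v = Any (λ e → Joins e u v) es

  Walk : List E → V → V → Set
  Walk es = Star (Adjacent es)

  -- The subgraph formed by a list of edges has those edges together with
  -- their endpoints; other vertices of G do not belong to it.
  Connected : List E → Set
  Connected es = ∀ u v → Any (Incident u) es → Any (Incident v) es → Walk es u v

  -- With 0-based positions, k stands for the prefix of length k + 1, so the
  -- prefix lengths range over 1, …, ∣E∣.
  IsShelling : Vec E ∣E∣ → Set
  IsShelling σ = Bijective _≡_ _≡_ (lookup σ)
               × (∀ (k : Fin ∣E∣) → Connected (take (suc (toℕ k)) (toList σ)))

  walk? : ∀ es u v → Dec (Walk es u v)
  walk? [] u v = map′ (λ { refl → ε }) to (u ≟ v)
    where
    to : ∀ {u v} → Walk [] u v → u ≡ v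
    to ε = refl
    to (() ◅ _)
  walk? (e ∷ es) u v =
    map′ from to (walk? es u v ⊎-dec (walk? es u a ×-dec walk? es b v)
                               ⊎-dec (walk? es u b ×-dec walk? es a v))
    where
    a b : V
    a = proj₁ (ends e)
    b = proj₂ (ends e)

    Split : V → V → Set
    Split u v = Walk es u v ⊎ (Walk es u a × Walk es b v) ⊎ (Walk es u b × Walk es a v)

    from : ∀ {u v} → Split u v → Walk (e ∷ es) u v
    from (inj₁ w) = Star.map there w
    from (inj₂ (inj₁ (w , w′))) =
      Star.map there w ◅◅ here (inj₁ (refl , refl)) ◅ Star.map there w′
    from (inj₂ (inj₂ (w , w′))) =
      Star.map there w ◅◅ here (inj₂ (refl , refl)) ◅ Star.map there w′

    to : ∀ {u v} → Walk (e ∷ es) u v → Split u v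
    to ε = inj₁ ε
    to (here (inj₁ (refl , refl)) ◅ w) with to w
    ... | inj₁ w₁               = inj₂ (inj₁ (ε , w₁))
    ... | inj₂ (inj₁ (_ , w₂))  = inj₂ (inj₁ (ε , w₂))
    ... | inj₂ (inj₂ (_ , w₂))  = inj₁ w₂
    to (here (inj₂ (refl , refl)) ◅ w) with to w
    ... | inj₁ w₁               = inj₂ (inj₂ (ε , w₁))
    ... | inj₂ (inj₁ (_ , w₂))  = inj₁ w₂
    ... | inj₂ (inj₂ (_ , w₂))  = inj₂ (inj₂ (ε , w₂))
    to (there x ◅ w) with to w
    ... | inj₁ w₁               = inj₁ (x ◅ w₁)
    ... | inj₂ (inj₁ (w₁ , w₂)) = inj₂ (inj₁ (x ◅ w₁ , w₂))
    ... | inj₂ (inj₂ (w₁ , w₂)) = inj₂ (inj₂ (x ◅ w₁ , w₂))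

  incident? : ∀ v e → Dec (Incident v e)
  incident? v e = (proj₁ (ends e) ≟ v) ⊎-dec (proj₂ (ends e) ≟ v)

  connected? : ∀ es → Dec (Connected es)
  connected? es = all? λ u → all? λ v →
    Any.any? (incident? u) es →-dec (Any.any? (incident? v) es →-dec walk? es u v)

bijective? : ∀ {m n} (f : Fin m → Fin n) → Dec (Bijective _≡_ _≡_ f)
bijective? f = injective? ×-dec surjective?
  where
  injective? : Dec (Injective _≡_ _≡_ f)
  injective? = map′ (λ h {x} {y} → h x y) (λ h x y → h {x} {y})
    (all? λ x → all? λ y → (f x ≟ f y) →-dec (x ≟ y))

  surjective? : Dec (Surjective _≡_ _≡_ f)
  surjective? = map′
    (λ h y → proj₁ (h y) , λ z≡x → trans (cong f z≡x) (proj₂ (h y)))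
    (λ h y → proj₁ (h y) , proj₂ (h y) refl)
    (all? λ y → any? λ x → f x ≟ y)

isShelling? : ∀ G σ → Dec (IsShelling G σ)
isShelling? G σ =
  bijective? (lookup σ) ×-dec all? λ k → connected? G (take (suc (toℕ k)) (toList σ))

sequences : ∀ n k → List (Vec (Fin n) k)
sequences n zero    = Vec.[] ∷ []
sequences n (suc k) = cartesianProductWith Vec._∷_ (allFin n) (sequences n k)

-- The next two lemmas make filtering `sequences` an exact count.
sequences-complete : ∀ {n k} (σ : Vec (Fin n) k) → σ ∈ sequences n k
sequences-complete Vec.[]       = here refl
sequences-complete (x Vec.∷ σ) =
  ∈-cartesianProductWith⁺ Vec._∷_ (∈-allFin x) (sequences-complete σ)

sequences-unique : ∀ n k → Unique (sequences n k)
sequences-unique n zero    = All.[] AllPairs.∷ AllPairs.[]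
sequences-unique n (suc k) =
  cartesianProductWith⁺ Vec._∷_ ∷-injective (allFin⁺ n) (sequences-unique n k)

-- The number of shellings.
F : Graph → ℕ
F G = length (filter (isShelling? G) (sequences ∣E∣ ∣E∣))
  where open Graph G

-- The complete bipartite graph: the parts are the first m and the last n
-- vertices, and `remQuot n` is the bijection Fin (m * n) → Fin m × Fin n, so
-- there is exactly one edge for each pair (a , b).
K : ℕ → ℕ → Graph
K m n = record
  { ∣V∣  = m + n
  ; ∣E∣  = m * n
  ; ends = λ e → let (a , b) = remQuot {m} n e in a ↑ˡ n , m ↑ʳ b
  }

module Submission where

-- Build a shelling edge by edge. If the edges used so far cover a left and b right vertices and
-- k edges remain, the number of ways to finish depends only on a, b and k: it equals
--   f(a, b, k) = (n + a - 1)! (m + b - 1)! k! / ((a + b - 1)! (m + n - 1)!).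
-- Indeed the next edge is one of a b - (m n - k) unused edges between covered vertices, one of
-- (m - a) b edges covering a new left vertex, or one of a (n - b) covering a new right vertex, and
-- the resulting recursion for f reduces to
--   (a + b) m n = a b (a + b) + (m - a) b (n + a) + a (n - b) (m + b).
-- The first edge is arbitrary, so the number of shellings is m n f(1, 1, m n - 1).

open import Defs
open import Data.Nat using (ℕ; NonZero; _+_; _*_; _∸_; _!)
open import Data.Nat.Properties using (_!≢0)
open import Data.Integer using (+_)
open import Data.Rational using (_/_)
open import Relation.Binary.PropositionalEquality using (_≡_)

import Algebra.Properties.Semiring.Sum
open import Data.Bool using (Bool; true; false; not)
open import Data.Fin using (Fin; zero; suc; toℕ; splitAt; _↑ˡ_; _↑ʳ_; combine; quotient; remainder)
open import Data.Fin.Properties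
  using ( _≟_; any?; injective⇒≤; splitAt-↑ˡ; splitAt-↑ʳ; ↑ˡ-injective; ↑ʳ-injective
        ; remQuot-combine)
import Data.Integer as ℤ
import Data.Integer.Properties as ℤ
open import Data.List as List
  using (List; []; _∷_; length; filter; take; tabulate; map; cartesianProductWith; _ʳ++_)
open import Data.List.Membership.Propositional using (_∈_; _∉_)
open import Data.List.Membership.Propositional.Properties using (∈-map⁺)
import Data.List.Membership.DecPropositional
open import Data.List.Properties using (filter-≐; filter-none; filter-++; length-++)
open import Data.List.Relation.Binary.Permutation.Propositional using (_↭_; ↭-trans; ↭-sym)
open import Data.List.Relation.Binary.Permutation.Propositional.Properties
  using (Any-resp-↭; ++↭ʳ++; ∷↭∷ʳ)
import Data.List.Relation.Unary.All as All
open import Data.List.Relation.Unary.Any as Any using (Any; here; there)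
open import Data.List.Relation.Unary.Any.Properties using (map⁺; map⁻)
open import Data.Nat using (zero; suc; _≤_)
open import Data.Nat.Properties
  using ( +-*-semiring; +-assoc; +-comm; +-suc; +-identityʳ; *-assoc; *-identityˡ; *-identityʳ; *-zeroʳ
        ; *-cancelˡ-≡; +-cancelʳ-≡; m≤m+n; 1+n≰n; suc-injective)
open import Data.Nat.Tactic.RingSolver using (solve-∀)
open import Data.Product using (_×_; _,_; proj₁; proj₂; ∃)
open import Data.Rational.Properties using (fromℚᵘ-cong)
open import Data.Rational.Unnormalised using (mkℚᵘ; *≡*)
open import Data.Sum as Sum using (_⊎_; inj₁; inj₂; [_,_]′)
open import Data.Unit using (⊤; tt)
open import Data.Vec as Vec using (Vec; lookup; toList)
open import Data.Vec.Properties using (tabulate∘lookup)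
import Data.Vec.Relation.Unary.All as VecAll
open import Data.Vec.Relation.Unary.All.Properties using (lookup⁻)
open import Data.Vec.Relation.Unary.AllPairs using ([]; _∷_)
open import Data.Vec.Relation.Unary.Unique.Propositional using (Unique)
open import Data.Vec.Relation.Unary.Unique.Propositional.Properties using (tabulate⁺; lookup-injective)
open import Function using (_∘_; id)
open import Function.Definitions using (Surjective)
open import Level using (Level)
open import Relation.Binary.Construct.Closure.ReflexiveTransitive as Star using (Star; ε; _◅_; _◅◅_)
open import Relation.Binary.PropositionalEquality
  using (_≢_; refl; sym; trans; cong; cong₂; subst; module ≡-Reasoning)
open import Relation.Nullary using (Dec; yes; no; ¬_; does; contradiction)
open import Relation.Nullary.Decidable using (_×-dec_; _⊎-dec_; ¬?; dec-true; dec-false)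
open import Relation.Unary using (Pred; Decidable)

open Algebra.Properties.Semiring.Sum +-*-semiring

private variable
  ℓ₁ ℓ₂ ℓ₃ p : Level
  A : Set ℓ₁
  B : Set ℓ₂
  C : Set ℓ₃

open module FinMembership {n} = Data.List.Membership.DecPropositional (_≟_ {n}) using (_∈?_)

-- Connectivity of prefixes

module _ (G : Graph) where
  open Graph G

  Meets : List E → E → Set
  Meets P e = Any (Incident G (proj₁ (ends e))) P ⊎ Any (Incident G (proj₂ (ends e))) P

  -- The first edge of a shelling is unconstrained, whereas `Meets [] e` is empty; hence the
  -- separate case.
  Attachable : List E → E → Set
  Attachable []         e = ⊤
  Attachable P@(_ ∷ _) e = Meets P e

  walk-sym : ∀ {P u v} → Walk G P u v → Walk G P v u
  walk-sym = Star.reverse (Any.map Sum.swap)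

  walk-along : ∀ {P e u v} → Incident G u e → Incident G v e → Walk G (e ∷ P) u v
  walk-along (inj₁ refl) (inj₁ refl) = ε
  walk-along (inj₁ refl) (inj₂ refl) = here (inj₁ (refl , refl)) ◅ ε
  walk-along (inj₂ refl) (inj₁ refl) = here (inj₂ (refl , refl)) ◅ ε
  walk-along (inj₂ refl) (inj₂ refl) = ε

  -- A common vertex of `e` and `P` serves as a hub: every covered vertex reaches it, either along
  -- `e` or inside `P`.
  connected-∷⁺ : ∀ {P e} → Connected G P → Attachable P e → Connected G (e ∷ P)
  connected-∷⁺ {[]} _ _ u v (here i) (here j) = walk-along i j
  connected-∷⁺ {P@(_ ∷ _)} {e} conn meets u v i j =
    walk-to-hub i ◅◅ walk-sym (walk-to-hub j)
    where
    hub : ∃ λ w → Incident G w e × Any (Incident G w) P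
    hub = [ (λ k → _ , inj₁ refl , k) , (λ k → _ , inj₂ refl , k) ]′ meets

    walk-to-hub : ∀ {u} → Any (Incident G u) (e ∷ P) → Walk G (e ∷ P) u (proj₁ hub)
    walk-to-hub (here i)  = walk-along i (proj₁ (proj₂ hub))
    walk-to-hub (there i) = Star.map there (conn _ _ i (proj₂ (proj₂ hub)))

  -- Steps along edges of `P` stay on vertices covered by `P`. The first step along `e`, or the end
  -- of the walk, therefore happens at an end of `e` that `P` covers.
  meets-of-walk : ∀ {P e u} → Any (Incident G u) P → Walk G (e ∷ P) u (proj₁ (ends e)) → Meets P e
  meets-of-walk i ε                             = inj₁ i
  meets-of-walk i (here (inj₁ (refl , _)) ◅ _) = inj₁ i
  meets-of-walk i (here (inj₂ (_ , refl)) ◅ _) = inj₂ i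
  meets-of-walk i (there a ◅ w)                 =
    meets-of-walk (Any.map [ inj₂ ∘ proj₂ , inj₁ ∘ proj₁ ]′ a) w

  connected-∷⁻ : ∀ {P e} → Connected G (e ∷ P) → Attachable P e
  connected-∷⁻ {[]}    _    = tt
  connected-∷⁻ {_ ∷ _} conn =
    meets-of-walk (here (inj₁ refl)) (conn _ _ (there (here (inj₁ refl))) (here (inj₁ refl)))

  -- Used edges accumulate in reverse, whereas prefixes list them in order; this bridges the two.
  connected-↭ : ∀ {P Q} → P ↭ Q → Connected G P → Connected G Q
  connected-↭ P↭Q conn u v i j =
    Star.map (Any-resp-↭ P↭Q)
      (conn u v (Any-resp-↭ (↭-sym P↭Q) i) (Any-resp-↭ (↭-sym P↭Q) j))

  ∷↭ʳ++ : ∀ e (P : List E) → e ∷ P ↭ P ʳ++ e ∷ []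
  ∷↭ʳ++ e P = ↭-trans (∷↭∷ʳ e P) (++↭ʳ++ P (e ∷ []))

  -- P lists the edges already used, latest first.
  Extends : ∀ {k} → List E → Vec E k → Set
  Extends P Vec.[]      = ⊤
  Extends P (e Vec.∷ τ) = (e ∉ P × Attachable P e) × Extends (e ∷ P) τ

  attachable? : ∀ P e → Dec (Attachable P e)
  attachable? []         e = yes tt
  attachable? P@(_ ∷ _) e =
    Any.any? (incident? G (proj₁ (ends e))) P ⊎-dec Any.any? (incident? G (proj₂ (ends e))) P

  extends? : ∀ {k} P (τ : Vec E k) → Dec (Extends P τ)
  extends? P Vec.[]      = yes tt
  extends? P (e Vec.∷ τ) = (¬? (e ∈? P) ×-dec attachable? P e) ×-dec extends? (e ∷ P) τ

  -- `ʳ++` puts the used edges back in order. For `P = []` this is by definition the prefix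
  -- condition of `IsShelling`, and moving the head of `τ` onto `P` only shifts the index.
  PrefixesConnected : ∀ {k} → List E → Vec E k → Set
  PrefixesConnected {k} P τ = (j : Fin k) → Connected G (P ʳ++ take (suc (toℕ j)) (toList τ))

  -- Freshness against `P` is carried along because it becomes uniqueness once the head of `τ` has
  -- joined `P`.
  extends⇒distinct : ∀ {k P} {τ : Vec E k} → Extends P τ →
    Unique τ × (∀ {e} → e ∈ P → VecAll.All (e ≢_) τ)
  extends⇒distinct {τ = Vec.[]}    _ = [] , λ _ → VecAll.[]
  extends⇒distinct {τ = x Vec.∷ τ} ((x∉P , _) , ext) with extends⇒distinct ext
  ... | unique , fresh =
    fresh (here refl) ∷ unique , λ e∈P → (λ { refl → x∉P e∈P }) VecAll.∷ fresh (there e∈P)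

  extends⇒connected : ∀ {k P} {τ : Vec E k} → Connected G P → Extends P τ → PrefixesConnected P τ
  extends⇒connected {P = P} {x Vec.∷ τ} conn ((_ , att) , ext) zero =
    connected-↭ (∷↭ʳ++ x P) (connected-∷⁺ conn att)
  extends⇒connected {τ = x Vec.∷ τ} conn ((_ , att) , ext) (suc j) =
    extends⇒connected (connected-∷⁺ conn att) ext j

  connected⇒extends : ∀ {k P} {τ : Vec E k} → Unique τ → (∀ {e} → e ∈ P → VecAll.All (e ≢_) τ) →
    PrefixesConnected P τ → Extends P τ
  connected⇒extends {τ = Vec.[]} _ _ _ = tt
  connected⇒extends {P = P} {x Vec.∷ τ} (x≢τ ∷ unique) fresh conn =
    ((λ x∈P → VecAll.head (fresh x∈P) refl) , connected-∷⁻ (connected-↭ (↭-sym (∷↭ʳ++ x P)) (conn zero))) ,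
    connected⇒extends unique (λ { (here refl) → x≢τ ; (there e∈P) → VecAll.tail (fresh e∈P) }) (conn ∘ suc)

  -- Pigeonhole: if `y` were missed, `y` followed by `σ` would list more distinct edges than there
  -- are.
  unique⇒surjective : ∀ {σ : Vec E ∣E∣} → Unique σ → Surjective _≡_ _≡_ (lookup σ)
  unique⇒surjective {σ} unique y with any? (λ i → lookup σ i ≟ y)
  ... | yes (i , eq) = i , λ { refl → eq }
  ... | no ¬hit = contradiction (injective⇒≤ (lookup-injective {xs = y Vec.∷ σ} y∷σ-unique _ _)) 1+n≰n
    where
    y∷σ-unique : Unique (y Vec.∷ σ)
    y∷σ-unique = lookup⁻ (λ i eq → ¬hit (i , sym eq)) ∷ unique

  isShelling⇒extends : ∀ {σ} → IsShelling G σ → Extends [] σ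
  isShelling⇒extends {σ} ((injective , _) , conn) =
    connected⇒extends (subst Unique (tabulate∘lookup σ) (tabulate⁺ injective)) (λ ()) conn

  extends⇒isShelling : ∀ {σ} → Extends [] σ → IsShelling G σ
  extends⇒isShelling ext with unique , _ ← extends⇒distinct ext =
    ((λ {i} {j} → lookup-injective unique i j) , unique⇒surjective unique) ,
    extends⇒connected (λ _ _ ()) ext

-- Counting

count : {P : Pred A p} → Decidable P → List A → ℕ
count P? xs = length (filter P? xs)

count-cong : {P Q : Pred A p} (P? : Decidable P) (Q? : Decidable Q) →
  (∀ {x} → P x → Q x) → (∀ {x} → Q x → P x) → ∀ xs → count P? xs ≡ count Q? xs
count-cong P? Q? to from xs = cong length (filter-≐ P? Q? (to , from) xs)

count-none : {P : Pred A p} (P? : Decidable P) → (∀ x → ¬ P x) → ∀ xs → count P? xs ≡ 0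
count-none P? ¬P xs = cong length (filter-none P? (All.universal ¬P xs))

count-map : {P : Pred B p} (P? : Decidable P) (f : A → B) → ∀ xs →
  count P? (map f xs) ≡ count (P? ∘ f) xs
count-map P? f []       = refl
count-map P? f (x ∷ xs) with does (P? (f x))
... | true  = cong suc (count-map P? f xs)
... | false = count-map P? f xs

-- Stated for `tabulate g` so that the induction goes through; `allFin n` is the case `g = id`.
count-product : {P : Pred C p} (P? : Decidable P) (f : A → B → C) → ∀ {n} (g : Fin n → A) ys →
  count P? (cartesianProductWith f (tabulate g) ys) ≡ ∑[ i < n ] count (P? ∘ f (g i)) ys
count-product P? f {zero}  g ys = refl
count-product P? f {suc n} g ys = begin
  count P? (map (f (g zero)) ys List.++ cartesianProductWith f (tabulate (g ∘ suc)) ys)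
    ≡⟨ cong length (filter-++ P? (map (f (g zero)) ys) _) ⟩
  length (filter P? (map (f (g zero)) ys) List.++ filter P? (cartesianProductWith f (tabulate (g ∘ suc)) ys))
    ≡⟨ length-++ (filter P? (map (f (g zero)) ys)) ⟩
  count P? (map (f (g zero)) ys) + count P? (cartesianProductWith f (tabulate (g ∘ suc)) ys)
    ≡⟨ cong₂ _+_ (count-map P? (f (g zero)) ys) (count-product P? f (g ∘ suc) ys) ⟩
  ∑[ i < suc n ] count (P? ∘ f (g i)) ys ∎
  where open ≡-Reasoning

module _ (G : Graph) where
  open Graph G

  completions : List E → ℕ → ℕ
  completions P k = count (extends? G P) (sequences ∣E∣ k)

  completionsVia : List E → ℕ → E → ℕ
  completionsVia P k e = count (extends? G P ∘ (e Vec.∷_)) (sequences ∣E∣ k)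

  F≡completions : F G ≡ completions [] ∣E∣
  F≡completions =
    count-cong (isShelling? G) (extends? G []) (isShelling⇒extends G) (extends⇒isShelling G) (sequences ∣E∣ ∣E∣)

  completions-suc : ∀ P k → completions P (suc k) ≡ ∑[ e < ∣E∣ ] completionsVia P k e
  completions-suc P k = count-product (extends? G P) Vec._∷_ id (sequences ∣E∣ k)

  completionsVia-yes : ∀ P k {e} → e ∉ P → Attachable G P e → completionsVia P k e ≡ completions (e ∷ P) k
  completionsVia-yes P k {e} e∉P att =
    count-cong (extends? G P ∘ (e Vec.∷_)) (extends? G (e ∷ P)) proj₂ ((e∉P , att) ,_) (sequences ∣E∣ k)

  completionsVia-no : ∀ P k {e} → ¬ (e ∉ P × Attachable G P e) → completionsVia P k e ≡ 0
  completionsVia-no P k {e} ¬ok =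
    count-none (extends? G P ∘ (e Vec.∷_)) (λ _ → ¬ok ∘ proj₁) (sequences ∣E∣ k)

-- Sums over Fin

⟦_⟧ : Bool → ℕ
⟦ true  ⟧ = 1
⟦ false ⟧ = 0

∑-const : ∀ n c → ∑[ i < n ] c ≡ n * c
∑-const zero    c = refl
∑-const (suc n) c = cong (_+_ c) (∑-const n c)

∑-indicator : ∀ {n} (x : Fin n) → ∑[ i < n ] ⟦ does (i ≟ x) ⟧ ≡ 1
∑-indicator {suc n} zero    = cong suc (trans (∑-const n 0) (*-zeroʳ n))
∑-indicator {suc n} (suc x) = ∑-indicator x

∑-+ : ∀ p q (f : Fin (p + q) → ℕ) → ∑[ e < p + q ] f e ≡ ∑[ i < p ] f (i ↑ˡ q) + ∑[ j < q ] f (p ↑ʳ j)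
∑-+ zero    q f = refl
∑-+ (suc p) q f = trans (cong (_+_ (f zero)) (∑-+ p q (f ∘ suc))) (sym (+-assoc (f zero) _ _))

∑-* : ∀ m n (f : Fin (m * n) → ℕ) → ∑[ e < m * n ] f e ≡ ∑[ i < m ] ∑[ j < n ] f (combine i j)
∑-* zero    n f = refl
∑-* (suc m) n f =
  trans (∑-+ n (m * n) f) (cong (_+_ (∑[ j < n ] f (j ↑ˡ (m * n)))) (∑-* m n (f ∘ (n ↑ʳ_))))

-- Each pair of ends belongs to exactly one edge, so the sum factors. With indicators for `f` and
-- `g` it counts the edges by whether each end is covered.
∑-quotient-remainder : ∀ m n (f : Fin m → ℕ) (g : Fin n → ℕ) →
  ∑[ e < m * n ] (f (quotient n e) * g (remainder {m} n e)) ≡ ∑[ i < m ] f i * ∑[ j < n ] g j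
∑-quotient-remainder m n f g = begin
  ∑[ e < m * n ] (f (quotient n e) * g (remainder {m} n e))
    ≡⟨ ∑-* m n _ ⟩
  ∑[ i < m ] ∑[ j < n ] (f (quotient n (combine i j)) * g (remainder {m} n (combine i j)))
    ≡⟨ sum-cong-≗ (λ i → sum-cong-≗ λ j →
         cong (λ q → f (proj₁ q) * g (proj₂ q)) (remQuot-combine i j)) ⟩
  ∑[ i < m ] ∑[ j < n ] (f i * g j)
    ≡⟨ sum-cong-≗ (λ i → sym (*-distribˡ-sum (f i) g)) ⟩
  ∑[ i < m ] (f i * ∑[ j < n ] g j)
    ≡⟨ sym (*-distribʳ-sum (∑[ j < n ] g j) f) ⟩
  ∑[ i < m ] f i * ∑[ j < n ] g j ∎
  where open ≡-Reasoning

-- Numbers of distinct values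

module _ {n : ℕ} where

  -- Sums of indicators, so that they combine directly with the sums over edges in the recursion.
  distinct missing : List (Fin n) → ℕ
  distinct xs = ∑[ i < n ] ⟦ does (i ∈? xs) ⟧
  missing  xs = ∑[ i < n ] ⟦ does (¬? (i ∈? xs)) ⟧

  distinct+missing : ∀ xs → distinct xs + missing xs ≡ n
  distinct+missing xs = begin
    distinct xs + missing xs
      ≡⟨ sym (∑-distrib-+ (λ i → ⟦ does (i ∈? xs) ⟧) (λ i → ⟦ does (¬? (i ∈? xs)) ⟧)) ⟩
    ∑[ i < n ] (⟦ does (i ∈? xs) ⟧ + ⟦ does (¬? (i ∈? xs)) ⟧)
      ≡⟨ sum-cong-≗ (λ i → one (does (i ∈? xs))) ⟩
    ∑[ i < n ] 1 ≡⟨ ∑-const n 1 ⟩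
    n * 1        ≡⟨ *-identityʳ n ⟩
    n            ∎
    where
    open ≡-Reasoning
    one : ∀ b → ⟦ b ⟧ + ⟦ not b ⟧ ≡ 1
    one true  = refl
    one false = refl

  distinct-∷-∈ : ∀ {x xs} → x ∈ xs → distinct (x ∷ xs) ≡ distinct xs
  distinct-∷-∈ {x} {xs} x∈xs = sum-cong-≗ pointwise
    where
    pointwise : ∀ i → ⟦ does (i ∈? x ∷ xs) ⟧ ≡ ⟦ does (i ∈? xs) ⟧
    pointwise i with i ≟ x
    ... | yes refl = cong ⟦_⟧ (sym (dec-true (x ∈? xs) x∈xs))
    ... | no  _    = refl

  distinct-∷-∉ : ∀ {x xs} → x ∉ xs → distinct (x ∷ xs) ≡ suc (distinct xs)
  distinct-∷-∉ {x} {xs} x∉xs = begin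
    distinct (x ∷ xs)
      ≡⟨ sum-cong-≗ pointwise ⟩
    ∑[ i < n ] (⟦ does (i ≟ x) ⟧ + ⟦ does (i ∈? xs) ⟧)
      ≡⟨ ∑-distrib-+ (λ i → ⟦ does (i ≟ x) ⟧) (λ i → ⟦ does (i ∈? xs) ⟧) ⟩
    ∑[ i < n ] ⟦ does (i ≟ x) ⟧ + distinct xs
      ≡⟨ cong (_+ distinct xs) (∑-indicator x) ⟩
    suc (distinct xs) ∎
    where
    open ≡-Reasoning
    pointwise : ∀ i → ⟦ does (i ∈? x ∷ xs) ⟧ ≡ ⟦ does (i ≟ x) ⟧ + ⟦ does (i ∈? xs) ⟧
    pointwise i with i ≟ x
    ... | yes refl = cong (suc ∘ ⟦_⟧) (sym (dec-false (x ∈? xs) x∉xs))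
    ... | no  _    = refl

  distinct-[_] : ∀ x → distinct (x ∷ []) ≡ 1
  distinct-[ x ] =
    trans (distinct-∷-∉ {x} {[]} λ ()) (cong suc (trans (∑-const n 0) (*-zeroʳ n)))

  -- Prepending an absent `x` would push the number of distinct values above `n`.
  distinct-full⁻ : ∀ {xs} → distinct xs ≡ n → ∀ x → x ∈ xs
  distinct-full⁻ {xs} full x with x ∈? xs
  ... | yes x∈xs = x∈xs
  ... | no  x∉xs = contradiction
    (subst (_≤ n) (trans (distinct-∷-∉ x∉xs) (cong suc full))
      (subst (distinct (x ∷ xs) ≤_) (distinct+missing (x ∷ xs)) (m≤m+n _ _)))
    1+n≰n

  distinct-full⁺ : ∀ {xs} → (∀ x → x ∈ xs) → distinct xs ≡ n
  distinct-full⁺ {xs} all = trans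
    (sum-cong-≗ λ i → cong ⟦_⟧ (dec-true (i ∈? xs) (all i)))
    (trans (∑-const n 1) (*-identityʳ n))

-- Complete bipartite graphs

module _ (m n : ℕ) where
  private
    G : Graph
    G = K m n

  open Graph G using (E)

  left : E → Fin m
  left = quotient n

  right : E → Fin n
  right = remainder {m} n

  -- A left vertex is never the right end of an edge: `splitAt` separates the two parts.
  incident-left : ∀ {i e} → Incident G (i ↑ˡ n) e → i ≡ left e
  incident-left (inj₁ eq) = sym (↑ˡ-injective n _ _ eq)
  incident-left {i} {e} (inj₂ eq) = contradiction
    (trans (sym (splitAt-↑ʳ m n (right e))) (trans (cong (splitAt m) eq) (splitAt-↑ˡ m i n))) λ ()

  incident-right : ∀ {j e} → Incident G (m ↑ʳ j) e → j ≡ right e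
  incident-right (inj₂ eq) = sym (↑ʳ-injective m _ _ eq)
  incident-right {j} {e} (inj₁ eq) = contradiction
    (trans (sym (splitAt-↑ʳ m n j)) (trans (cong (splitAt m) (sym eq)) (splitAt-↑ˡ m (left e) n))) λ ()

  meets⁺ : ∀ {P e} → left e ∈ map left P ⊎ right e ∈ map right P → Meets G P e
  meets⁺ = Sum.map
    (Any.map (λ eq → inj₁ (cong (_↑ˡ n) (sym eq))) ∘ map⁻)
    (Any.map (λ eq → inj₂ (cong (m ↑ʳ_) (sym eq))) ∘ map⁻)

  meets⁻ : ∀ {P e} → Meets G P e → left e ∈ map left P ⊎ right e ∈ map right P
  meets⁻ = Sum.map (map⁺ ∘ Any.map incident-left) (map⁺ ∘ Any.map incident-right)

  -- One step of the recursion, its solution left abstract. `D` clears denominators; `X`, `Y`, `Z`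
  -- are the scaled counts after an edge between covered vertices, to a new left vertex, or to a new
  -- right vertex.
  module _ (e₀ : E) (Q : List E) (k D X Y Z : ℕ) where
    private
      P : List E
      P = e₀ ∷ Q

    module _
      (inner    : ∀ {e} → e ∉ P → left e ∈ map left P → right e ∈ map right P →
                  completions G (e ∷ P) k * D ≡ X)
      (newLeft  : ∀ {e} → e ∉ P → left e ∉ map left P → right e ∈ map right P →
                  completions G (e ∷ P) k * D ≡ Y)
      (newRight : ∀ {e} → e ∉ P → left e ∈ map left P → right e ∉ map right P →
                  completions G (e ∷ P) k * D ≡ Z)
      where

      -- A used edge contributes no completion but joins covered vertices. Adding `X` for it on the
      -- left lets the first term on the right range over all covered pairs, which avoids the
      -- subtraction in a b - (m n - k).
      completionsVia-balance : ∀ e (used : Dec (e ∈ P))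
        (l : Dec (left e ∈ map left P)) (r : Dec (right e ∈ map right P)) →
        completionsVia G P k e * D + ⟦ does used ⟧ * X ≡
        ⟦ does l ⟧ * ⟦ does r ⟧ * X + ⟦ does (¬? l) ⟧ * ⟦ does r ⟧ * Y + ⟦ does l ⟧ * ⟦ does (¬? r) ⟧ * Z
      completionsVia-balance e (yes e∈P) (yes _) (yes _)
        rewrite completionsVia-no G P k (λ ok → proj₁ ok e∈P) = sym (trans (+-identityʳ _) (+-identityʳ _))
      completionsVia-balance e (yes e∈P) (no l∉) _       = contradiction (∈-map⁺ left e∈P) l∉
      completionsVia-balance e (yes e∈P) _       (no r∉) = contradiction (∈-map⁺ right e∈P) r∉
      completionsVia-balance e (no e∉P) (yes l∈) (yes r∈)
        rewrite completionsVia-yes G P k e∉P (meets⁺ (inj₁ l∈)) | inner e∉P l∈ r∈ = shape X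
        where
        shape : ∀ x → x + 0 ≡ 1 * 1 * x + 0 + 0
        shape = solve-∀
      completionsVia-balance e (no e∉P) (no l∉) (yes r∈)
        rewrite completionsVia-yes G P k e∉P (meets⁺ (inj₂ r∈)) | newLeft e∉P l∉ r∈ = shape Y
        where
        shape : ∀ y → y + 0 ≡ 0 + 1 * 1 * y + 0
        shape = solve-∀
      completionsVia-balance e (no e∉P) (yes l∈) (no r∉)
        rewrite completionsVia-yes G P k e∉P (meets⁺ (inj₁ l∈)) | newRight e∉P l∈ r∉ = shape Z
        where
        shape : ∀ z → z + 0 ≡ 0 + 0 + 1 * 1 * z
        shape = solve-∀
      -- An edge with neither end covered cannot come next, so both sides vanish.
      completionsVia-balance e (no e∉P) (no l∉) (no r∉)
        rewrite completionsVia-no G P k ([ l∉ , r∉ ]′ ∘ meets⁻ ∘ proj₂) = refl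

      completions-balance :
        completions G P (suc k) * D + distinct P * X ≡
        distinct (map left P) * distinct (map right P) * X
          + missing (map left P) * distinct (map right P) * Y
          + distinct (map left P) * missing (map right P) * Z
      completions-balance = begin
        completions G P (suc k) * D + distinct P * X
          ≡⟨ cong₂ _+_
               (trans (cong (_* D) (completions-suc G P k)) (*-distribʳ-sum D (completionsVia G P k)))
               (*-distribʳ-sum X (λ e → ⟦ does (e ∈? P) ⟧)) ⟩
        ∑[ e < m * n ] (completionsVia G P k e * D) + ∑[ e < m * n ] (⟦ does (e ∈? P) ⟧ * X)
          ≡⟨ sym (∑-distrib-+ (λ e → completionsVia G P k e * D) (λ e → ⟦ does (e ∈? P) ⟧ * X)) ⟩
        ∑[ e < m * n ] (completionsVia G P k e * D + ⟦ does (e ∈? P) ⟧ * X)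
          ≡⟨ sum-cong-≗ (λ e → completionsVia-balance e (e ∈? P) (left e ∈? map left P) (right e ∈? map right P)) ⟩
        ∑[ e < m * n ] (L (left e) * R (right e) * X + L̄ (left e) * R (right e) * Y + L (left e) * R̄ (right e) * Z)
          ≡⟨ trans (∑-distrib-+ (λ e → L (left e) * R (right e) * X + L̄ (left e) * R (right e) * Y)
                                (λ e → L (left e) * R̄ (right e) * Z))
                   (cong (_+ ∑[ e < m * n ] (L (left e) * R̄ (right e) * Z))
                     (∑-distrib-+ (λ e → L (left e) * R (right e) * X)
                                  (λ e → L̄ (left e) * R (right e) * Y))) ⟩
        ∑[ e < m * n ] (L (left e) * R (right e) * X) + ∑[ e < m * n ] (L̄ (left e) * R (right e) * Y)
          + ∑[ e < m * n ] (L (left e) * R̄ (right e) * Z)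
          ≡⟨ cong₂ _+_ (cong₂ _+_ (factor L R X) (factor L̄ R Y)) (factor L R̄ Z) ⟩
        distinct (map left P) * distinct (map right P) * X
          + missing (map left P) * distinct (map right P) * Y
          + distinct (map left P) * missing (map right P) * Z ∎
        where
        open ≡-Reasoning
        L L̄ : Fin m → ℕ
        L  i = ⟦ does (i ∈? map left P) ⟧
        L̄ i = ⟦ does (¬? (i ∈? map left P)) ⟧
        R R̄ : Fin n → ℕ
        R  j = ⟦ does (j ∈? map right P) ⟧
        R̄ j = ⟦ does (¬? (j ∈? map right P)) ⟧
        factor : ∀ (f : Fin m → ℕ) (g : Fin n → ℕ) c →
          ∑[ e < m * n ] (f (left e) * g (right e) * c) ≡ ∑[ i < m ] f i * ∑[ j < n ] g j * c
        factor f g c = trans (sym (*-distribʳ-sum c (λ e → f (left e) * g (right e))))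
          (cong (_* c) (∑-quotient-remainder m n f g))

-- Here m = a + ā and n = b + b̄.
balance-identity : ∀ a ā b b̄ c →
  a * b * ((a + b) * c) + ā * b * ((b + b̄ + a) * c) + a * b̄ * ((a + ā + b) * c) ≡
  (a + b) * ((a + ā) * (b + b̄) * c)
balance-identity = solve-∀

-- Solving the recursion in closed form

module _ (m′ n′ : ℕ) where
  private
    m n M : ℕ
    m = suc m′
    n = suc n′
    M = m + n ∸ 1

    l : Fin (m * n) → Fin m
    l = left m n

    r : Fin (m * n) → Fin n
    r = right m n

  -- a′ = a - 1 and b′ = b - 1, so that no subtraction occurs.
  completions-formula : ∀ k e₀ Q a′ b′ → let P = e₀ ∷ Q in
    distinct (map l P) ≡ suc a′ → distinct (map r P) ≡ suc b′ → distinct P + k ≡ m * n →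
    completions (K m n) P k * (suc (a′ + b′) ! * M !) ≡ (n + a′) ! * (m + b′) ! * k !
  completions-formula zero e₀ Q a′ b′ a≡ b≡ t≡ = begin
    1 * (suc (a′ + b′) ! * M !)             ≡⟨ *-identityˡ _ ⟩
    suc (a′ + b′) ! * M !                   ≡⟨ cong₂ (λ a b → suc (a + b) ! * M !) a′≡m′ b′≡n′ ⟩
    suc (m′ + n′) ! * (m′ + n) !            ≡⟨ cong₂ (λ x y → suc x ! * y !) (+-comm m′ n′) (+-suc m′ n′) ⟩
    (n + m′) ! * (m + n′) !                 ≡⟨ cong₂ (λ a b → (n + a) ! * (m + b) !) (sym a′≡m′) (sym b′≡n′) ⟩
    (n + a′) ! * (m + b′) !                 ≡⟨ sym (*-identityʳ _) ⟩
    (n + a′) ! * (m + b′) ! * 1             ∎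
    where
    open ≡-Reasoning
    -- With no edge remaining, all m n edges are used. Both parts are nonempty, so every vertex is
    -- an end of some edge, which forces a = m and b = n.
    used : ∀ e → e ∈ e₀ ∷ Q
    used = distinct-full⁻ (trans (sym (+-identityʳ _)) t≡)

    a′≡m′ : a′ ≡ m′
    a′≡m′ = suc-injective (trans (sym a≡) (distinct-full⁺ λ i →
      subst (_∈ map l (e₀ ∷ Q)) (cong proj₁ (remQuot-combine i (zero {n′})))
        (∈-map⁺ l (used (combine i zero)))))

    b′≡n′ : b′ ≡ n′
    b′≡n′ = suc-injective (trans (sym b≡) (distinct-full⁺ λ j →
      subst (_∈ map r (e₀ ∷ Q)) (cong proj₂ (remQuot-combine (zero {m′}) j))
        (∈-map⁺ r (used (combine (zero {m′}) j)))))

  completions-formula (suc k) e₀ Q a′ b′ a≡ b≡ t≡ =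
    -- `scaled` is the claim multiplied by a + b, with the contribution of the used edges added to
    -- both sides; both are cancelled here.
    trans (*-cancelˡ-≡ _ _ s (+-cancelʳ-≡ _ _ _ scaled)) (shape₄ ((n + a′) !) ((m + b′) !) k (k !))
    where
    open ≡-Reasoning
    P : List (Fin (m * n))
    P = e₀ ∷ Q
    f : ℕ
    f = completions (K m n) P (suc k)
    -- Here `s` is a + b and `d` is (a + b - 1)! (m + n - 1)!. Covering a new vertex turns (a + b -
    -- 1)! into (a + b)!, so `s * d` serves as common denominator in all three cases.
    s d c : ℕ
    s = suc a′ + suc b′
    d = suc (a′ + b′) ! * M !
    c = (n + a′) ! * (m + b′) ! * k !

    t+k≡ : suc (distinct P) + k ≡ m * n
    t+k≡ = trans (sym (+-suc (distinct P) k)) t≡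

    step : ∀ {e} → e ∉ P → distinct (e ∷ P) + k ≡ m * n
    step e∉P = trans (cong (_+ k) (distinct-∷-∉ e∉P)) t+k≡

    s≡ : suc (suc (a′ + b′)) ≡ s
    s≡ = cong suc (sym (+-suc a′ b′))

    inner : ∀ {e} → e ∉ P → l e ∈ map l P → r e ∈ map r P →
            completions (K m n) (e ∷ P) k * (s * d) ≡ s * c
    inner {e} e∉P l∈ r∈ = begin
      completions (K m n) (e ∷ P) k * (s * d) ≡⟨ shape₁ (completions (K m n) (e ∷ P) k) s d ⟩
      s * (completions (K m n) (e ∷ P) k * d)
        ≡⟨ cong (s *_) (completions-formula k e P a′ b′
             (trans (distinct-∷-∈ l∈) a≡) (trans (distinct-∷-∈ r∈) b≡) (step e∉P)) ⟩
      s * c ∎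
      where
      shape₁ : ∀ x y z → x * (y * z) ≡ y * (x * z)
      shape₁ = solve-∀

    s*d≡ : s * d ≡ suc (suc (a′ + b′)) ! * M !
    s*d≡ = trans (cong (_* d) (sym s≡)) (sym (*-assoc (suc (suc (a′ + b′))) (suc (a′ + b′) !) (M !)))

    -- The new left vertex supplies the factor `s` in the denominator and turns (n + a - 1)! into (n
    -- + a)!, whence the weight n + a.
    newLeft : ∀ {e} → e ∉ P → l e ∉ map l P → r e ∈ map r P →
              completions (K m n) (e ∷ P) k * (s * d) ≡ (n + suc a′) * c
    newLeft {e} e∉P l∉ r∈ = begin
      completions (K m n) (e ∷ P) k * (s * d)
        ≡⟨ cong (completions (K m n) (e ∷ P) k *_) s*d≡ ⟩
      completions (K m n) (e ∷ P) k * (suc (suc a′ + b′) ! * M !)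
        ≡⟨ completions-formula k e P (suc a′) b′
             (trans (distinct-∷-∉ l∉) (cong suc a≡)) (trans (distinct-∷-∈ r∈) b≡) (step e∉P) ⟩
      (n + suc a′) ! * (m + b′) ! * k !
        ≡⟨ cong (λ x → x ! * (m + b′) ! * k !) (+-suc n a′) ⟩
      suc (n + a′) * (n + a′) ! * (m + b′) ! * k !
        ≡⟨ shape (suc (n + a′)) ((n + a′) !) ((m + b′) !) (k !) ⟩
      suc (n + a′) * c
        ≡⟨ cong (_* c) (sym (+-suc n a′)) ⟩
      (n + suc a′) * c ∎
      where
      shape : ∀ w x y z → w * x * y * z ≡ w * (x * y * z)
      shape = solve-∀

    -- Symmetrically, (m + b - 1)! becomes (m + b)!, whence the weight m + b.
    newRight : ∀ {e} → e ∉ P → l e ∈ map l P → r e ∉ map r P →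
               completions (K m n) (e ∷ P) k * (s * d) ≡ (m + suc b′) * c
    newRight {e} e∉P l∈ r∉ = begin
      completions (K m n) (e ∷ P) k * (s * d)
        ≡⟨ cong (completions (K m n) (e ∷ P) k *_)
             (trans s*d≡ (cong (λ x → suc x ! * M !) (sym (+-suc a′ b′)))) ⟩
      completions (K m n) (e ∷ P) k * (suc (a′ + suc b′) ! * M !)
        ≡⟨ completions-formula k e P a′ (suc b′)
             (trans (distinct-∷-∈ l∈) a≡) (trans (distinct-∷-∉ r∉) (cong suc b≡)) (step e∉P) ⟩
      (n + a′) ! * (m + suc b′) ! * k !
        ≡⟨ cong (λ x → (n + a′) ! * x ! * k !) (+-suc m b′) ⟩
      (n + a′) ! * (suc (m + b′) * (m + b′) !) * k !
        ≡⟨ shape (suc (m + b′)) ((n + a′) !) ((m + b′) !) (k !) ⟩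
      suc (m + b′) * c
        ≡⟨ cong (_* c) (sym (+-suc m b′)) ⟩
      (m + suc b′) * c ∎
      where
      shape : ∀ w x y z → x * (w * y) * z ≡ w * (x * y * z)
      shape = solve-∀

    ā b̄ : ℕ
    ā = missing (map l P)
    b̄ = missing (map r P)

    m≡ : suc a′ + ā ≡ m
    m≡ = trans (cong (_+ ā) (sym a≡)) (distinct+missing (map l P))

    n≡ : suc b′ + b̄ ≡ n
    n≡ = trans (cong (_+ b̄) (sym b≡)) (distinct+missing (map r P))

    shape₂ : ∀ s t k c → s * ((t + k) * c) ≡ s * (k * c) + t * (s * c)
    shape₂ = solve-∀

    shape₃ : ∀ f s d → s * (f * d) ≡ f * (s * d)
    shape₃ = solve-∀

    shape₄ : ∀ x y k z → suc k * (x * y * z) ≡ x * y * (suc k * z)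
    shape₄ = solve-∀

    scaled : s * (f * d) + distinct P * (s * c) ≡ s * (suc k * c) + distinct P * (s * c)
    scaled = begin
      s * (f * d) + distinct P * (s * c)
        ≡⟨ cong (_+ distinct P * (s * c)) (shape₃ f s d) ⟩
      f * (s * d) + distinct P * (s * c)
        ≡⟨ completions-balance m n e₀ Q k (s * d) (s * c) _ _ inner newLeft newRight ⟩
      distinct (map l P) * distinct (map r P) * (s * c)
        + ā * distinct (map r P) * ((n + suc a′) * c) + distinct (map l P) * b̄ * ((m + suc b′) * c)
        ≡⟨ cong₂ (λ a b → a * b * (s * c) + ā * b * ((n + suc a′) * c) + a * b̄ * ((m + suc b′) * c)) a≡ b≡ ⟩
      suc a′ * suc b′ * (s * c) + ā * suc b′ * ((n + suc a′) * c) + suc a′ * b̄ * ((m + suc b′) * c)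
        ≡⟨ cong₂ (λ m n → suc a′ * suc b′ * (s * c) + ā * suc b′ * ((n + suc a′) * c) + suc a′ * b̄ * ((m + suc b′) * c))
             (sym m≡) (sym n≡) ⟩
      suc a′ * suc b′ * (s * c) + ā * suc b′ * ((suc b′ + b̄ + suc a′) * c)
        + suc a′ * b̄ * ((suc a′ + ā + suc b′) * c)
        ≡⟨ balance-identity (suc a′) ā (suc b′) b̄ c ⟩
      s * ((suc a′ + ā) * (suc b′ + b̄) * c)
        ≡⟨ cong₂ (λ m n → s * (m * n * c)) m≡ n≡ ⟩
      s * (m * n * c)
        -- Splitting m n into used and remaining edges isolates the term added for the used edges.
        ≡⟨ cong (λ x → s * (x * c)) (sym t≡) ⟩
      s * ((distinct P + suc k) * c)
        ≡⟨ shape₂ s (distinct P) (suc k) c ⟩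
      s * (suc k * c) + distinct P * (s * c) ∎

  F-K : F (K m n) * M ! ≡ m ! * n ! * (m * n) !
  F-K = begin
    F (K m n) * M !
      ≡⟨ cong (_* M !) (trans (F≡completions (K m n)) (completions-suc (K m n) [] N)) ⟩
    ∑[ e < m * n ] completionsVia (K m n) [] N e * M !
      ≡⟨ *-distribʳ-sum (M !) (completionsVia (K m n) [] N) ⟩
    ∑[ e < m * n ] (completionsVia (K m n) [] N e * M !)
      ≡⟨ sum-cong-≗ first ⟩
    ∑[ e < m * n ] (n ! * m ! * N !)
      ≡⟨ ∑-const (m * n) _ ⟩
    m * n * (n ! * m ! * N !)
      ≡⟨ shape (m * n) (n !) (m !) (N !) ⟩
    m ! * n ! * (m * n) ! ∎
    where
    open ≡-Reasoning
    N : ℕ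
    -- This is m n - 1 in the form for which `suc N` is `m * n` by computation; thus also
    -- `m * n * N !` is `(m * n) !`.
    N = n′ + m′ * n

    shape : ∀ w x y z → w * (x * y * z) ≡ y * x * (w * z)
    shape = solve-∀

    first : ∀ e → completionsVia (K m n) [] N e * M ! ≡ n ! * m ! * N !
    first e = begin
      completionsVia (K m n) [] N e * M !
        ≡⟨ cong (_* M !) (completionsVia-yes (K m n) [] N (λ ()) tt) ⟩
      completions (K m n) (e ∷ []) N * M !
        -- `1 !` is the factor (a + b - 1)! at a = b = 1: a single edge covers one vertex of each
        -- part.
        ≡⟨ cong (completions (K m n) (e ∷ []) N *_) (sym (*-identityˡ (M !))) ⟩
      completions (K m n) (e ∷ []) N * (1 ! * M !)
        ≡⟨ completions-formula N e [] 0 0 distinct-[ l e ] distinct-[ r e ] (cong (_+ N) distinct-[ e ]) ⟩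
      (n + 0) ! * (m + 0) ! * N !
        ≡⟨ cong₂ (λ x y → x ! * y ! * N !) (+-identityʳ n) (+-identityʳ m) ⟩
      n ! * m ! * N ! ∎

-- From natural numbers to the rational quotient

/-unique : ∀ f x d .{{_ : NonZero d}} → f * d ≡ x → + f / 1 ≡ + x / d
-- Unnormalised fractions are compared by cross-multiplication, and normalisation respects that
-- equality. `mkℚᵘ` stores the denominator minus one, hence the `0` and the `d`.
/-unique f x (suc d) eq = fromℚᵘ-cong {mkℚᵘ (+ f) 0} {mkℚᵘ (+ x) d}
  (*≡* (begin
    + f ℤ.* + suc d ≡⟨ sym (ℤ.pos-* f (suc d)) ⟩
    + (f * suc d)   ≡⟨ cong +_ eq ⟩
    + x             ≡⟨ sym (ℤ.*-identityʳ (+ x)) ⟩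
    + x ℤ.* + 1     ∎))
  where open ≡-Reasoning

theorem2p1 : (m n : ℕ) → .{{_ : NonZero m}} → .{{_ : NonZero n}} →
    + F (K m n) / 1 ≡ _/_ (+ (m ! * n ! * (m * n) !)) ((m + n ∸ 1) !) {{(m + n ∸ 1) !≢0}}
theorem2p1 (suc m′) (suc n′) =
  /-unique (F (K (suc m′) (suc n′))) _ ((suc m′ + suc n′ ∸ 1) !) {{(suc m′ + suc n′ ∸ 1) !≢0}} (F-K m′ n′)
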